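{- Let $V=\{1,\dots,n\}$ and let $f:2^V\to\mathbb{R}$ be submodular with $f(\emptyset)=0$ and $M^{\natural}$-concave on $\{0,1\}^V$. Then for every $X\subseteq V$, $\partial^f(X)=\partial^f_{\Delta(2,2)}(X)$, where $\partial^f(X)=\{x\in\mathbb{R}^n: f(Y)-x(Y)\le f(X)-x(X)\ \forall Y\subseteq V\}$ and $\partial^f_{\Delta(2,2)}(X)=\{x\in\mathbb{R}^n: f(Y)-x(Y)\le f(X)-x(X)$ for all $Y\subseteq V$ such that $Y\subseteq X$, or $Y\supseteq X$, or ($|Y\setminus X|\le 1$ and $|X\setminus Y|\le1$)$\}$. In particular, $\partial^f(X)$ can be described by $O(n^2)$ linear inequalities.
   Context: For $x\in\mathbb{R}^n$ and $S\subseteq V$, $x(S)=\sum_{i\in S}x_i$. $f$ is submodular if $f(S)+f(T)\ge f(S\cup T)+f(S\cap T)$ for all $S,T\subseteq V$. A set function $\mu:2^V\to\mathbb{R}$ is $M^{\natural}$-concave if for all $X,Y\subseteq V$ and every $i\in X\setminus Y$, either $\mu(X)+\mu(Y)\le\mu(X\setminus\{i\})+\mu(Y\cup\{i\})$, or there exists $j\in Y\setminus X$ with $\mu(X)+\mu(Y)\le\mu((X\setminus\{i\})\cup\{j\})+\mu((Y\cup\{i\})\setminus\{j\})$. -}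

module Defs where

open import Level using (Level; suc; _⊔_)
open import Data.Nat as ℕ using (ℕ; zero; _≤_)
open import Data.Fin using (Fin)
import Data.Fin as F
open import Data.Bool using (Bool; true; false; if_then_else_)
open import Data.Vec using (_∷_; [])
open import Data.Fin.Subset using (Subset; _∈_; _∉_; _⊆_; _⊇_; _∪_; _∩_; _─_; _-_; ⁅_⁆; ∣_∣)
open import Data.Product using (Σ; _×_)
open import Data.Sum using (_⊎_)
open import Relation.Binary.PropositionalEquality using (_≡_)

-- A linearly ordered abelian group (ℝ with + and ≤ is an instance).
-- The statement only uses addition, subtraction and the order of ℝ.
record OrderedAbelianGroup (a ℓ : Level) : Set (Level.suc (a ⊔ ℓ)) where
  infixl 6 _+_ _-ᵍ_
  infix 4 _≤ᵍ_
  field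
    Carrier    : Set a
    _+_        : Carrier → Carrier → Carrier
    0#         : Carrier
    -_         : Carrier → Carrier
    _≤ᵍ_       : Carrier → Carrier → Set ℓ
    +-assoc    : ∀ x y z → (x + y) + z ≡ x + (y + z)
    +-comm     : ∀ x y → x + y ≡ y + x
    +-identityˡ : ∀ x → 0# + x ≡ x
    -‿inverseˡ : ∀ x → (- x) + x ≡ 0#
    ≤-refl     : ∀ {x} → x ≤ᵍ x
    ≤-trans    : ∀ {x y z} → x ≤ᵍ y → y ≤ᵍ z → x ≤ᵍ z
    ≤-antisym  : ∀ {x y} → x ≤ᵍ y → y ≤ᵍ x → x ≡ y
    ≤-total    : ∀ x y → x ≤ᵍ y ⊎ y ≤ᵍ x
    +-monoˡ-≤  : ∀ {x y} z → x ≤ᵍ y → x + z ≤ᵍ y + z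

  _-ᵍ_ : Carrier → Carrier → Carrier
  x -ᵍ y = x + (- y)

module _ {a ℓ : Level} (G : OrderedAbelianGroup a ℓ) where
  open OrderedAbelianGroup G

  sumOver : ∀ {n} → (Fin n → Carrier) → Subset n → Carrier
  sumOver {zero}    x []            = 0#
  sumOver {ℕ.suc n} x (b ∷ S) =
    (if b then x F.zero else 0#) + sumOver (λ i → x (F.suc i)) S

  Submodular : ∀ {n} → (Subset n → Carrier) → Set ℓ
  Submodular f = ∀ S T → f (S ∪ T) + f (S ∩ T) ≤ᵍ f S + f T

  MnatConcave : ∀ {n} → (Subset n → Carrier) → Set ℓ
  MnatConcave {n} μ = ∀ X Y (i : Fin n) → i ∈ X → i ∉ Y →
      (μ X + μ Y ≤ᵍ μ (X - i) + μ (Y ∪ ⁅ i ⁆))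
    ⊎ Σ (Fin n) (λ j → j ∈ Y × j ∉ X ×
        (μ X + μ Y ≤ᵍ μ ((X - i) ∪ ⁅ j ⁆) + μ ((Y ∪ ⁅ i ⁆) - j)))

  InSubdiff : ∀ {n} → (Subset n → Carrier) → Subset n → (Fin n → Carrier) → Set ℓ
  InSubdiff f X x = ∀ Y → f Y -ᵍ sumOver x Y ≤ᵍ f X -ᵍ sumOver x X

  InSubdiffΔ22 : ∀ {n} → (Subset n → Carrier) → Subset n → (Fin n → Carrier) → Set ℓ
  InSubdiffΔ22 f X x = ∀ Y →
    (Y ⊆ X ⊎ Y ⊇ X ⊎ (∣ Y ─ X ∣ ≤ 1 × ∣ X ─ Y ∣ ≤ 1)) →
    f Y -ᵍ sumOver x Y ≤ᵍ f X -ᵍ sumOver x X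

module Submission where

-- Write g for the tilted function Y ↦ f(Y) - x(Y).  Then x ∈ ∂^f(X) says
-- that X maximises g globally, and x ∈ ∂^f_{Δ(2,2)}(X) says that X
-- maximises g among the sets Y with Y ⊆ X, Y ⊇ X, or Y a (1,1)-neighbour
-- of X.  The proof has two parts.
--  * Y ↦ x(Y) is modular, so the exchange moves in the definition of
--    M♮-concavity leave x(X) + x(Y) unchanged; hence g is M♮-concave
--    whenever f is (tilt-MnatConcave).
--  * For any M♮-concave g, Δ(2,2)-local maximality of X implies global
--    maximality (Δ22-maximal⇒maximal), by induction on |Y ∖ X|: if Y ⊈ X,
--    pick i ∈ Y ∖ X and exchange it against X.  This yields either
--    (Y - i, X + i) or (Y - i + j, X + i - j) with j ∈ X; the first set is
--    closer to X, the second is a superset or a (1,1)-neighbour of X.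

open import Defs
open import Level using (Level)
open import Data.Nat using (ℕ)
open import Data.Fin using (Fin)
open import Data.Fin.Subset using (Subset; ⊥)
open import Data.Product using (_×_)
open import Relation.Binary.PropositionalEquality using (_≡_)

open import Data.Nat using (zero; suc; _≤_; _<_; s≤s⁻¹)
open import Data.Nat.Properties using (<-≤-trans; n<1+n)
open import Data.Fin using (zero; suc)
open import Data.Fin.Subset using (Side; _∈_; _∉_; _⊆_; _⊇_; _∪_; _─_; _-_; ⁅_⁆; ∣_∣; inside; outside)
open import Data.Fin.Subset.Properties
  using (x∈p∧x∉q⇒x∈p─q; p⊆p∪q; x∈p∪q⁻; ∣⁅x⁆∣≡1; p⊆q⇒∣p∣≤∣q∣; p─q─r≡p─r─q;
         x∈p⇒∣p-x∣<∣p∣; p─⊥≡p; p─q⊆p; ∪-identityʳ; _∈?_)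
open import Data.Vec using ([]; _∷_; here; there)
open import Data.Bool using (_∨_; if_then_else_)
open import Data.Bool.Properties using (∨-identityʳ)
open import Data.Product using (∃; _,_)
open import Data.Sum using (_⊎_; inj₁; inj₂)
open import Relation.Nullary using (yes; no; contradiction)
open import Relation.Binary.PropositionalEquality
  using (sym; trans; cong; cong₂; subst; subst₂; isEquivalence; module ≡-Reasoning)
open import Algebra.Bundles using (AbelianGroup)
open import Algebra.Structures using (IsAbelianGroup)
open import Algebra.Consequences.Propositional using (comm∧idˡ⇒id; comm∧invˡ⇒inv)
import Algebra.Properties.AbelianGroup as AbelianGroupProperties
import Algebra.Properties.CommutativeSemigroup as CommutativeSemigroupProperties
import Algebra.Properties.Group as GroupProperties

x∈p─q⁻ : ∀ {n} {k : Fin n} (p q : Subset n) → k ∈ p ─ q → k ∈ p × k ∉ q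
x∈p─q⁻ (inside ∷ p) (outside ∷ q) here = here , λ ()
x∈p─q⁻ {k = zero} (outside ∷ p) (inside ∷ q) ()
x∈p─q⁻ {k = zero} (outside ∷ p) (outside ∷ q) ()
x∈p─q⁻ (_ ∷ p) (_ ∷ q) (there k∈p─q) with x∈p─q⁻ p q k∈p─q
... | k∈p , k∉q = there k∈p , λ { (there k∈q) → k∉q k∈q }

⊆-or-∃∈─ : ∀ {n} (p q : Subset n) → p ⊆ q ⊎ ∃ λ i → i ∈ p × i ∉ q
⊆-or-∃∈─ [] [] = inj₁ λ ()
⊆-or-∃∈─ (s ∷ p) (t ∷ q) with ⊆-or-∃∈─ p q
... | inj₂ (i , i∈p , i∉q) = inj₂ (suc i , there i∈p , λ { (there i∈q) → i∉q i∈q })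
⊆-or-∃∈─ (outside ∷ p) (t ∷ q) | inj₁ p⊆q = inj₁ λ { (there k∈p) → there (p⊆q k∈p) }
⊆-or-∃∈─ (inside ∷ p) (inside ∷ q) | inj₁ p⊆q =
  inj₁ λ { here → here ; (there k∈p) → there (p⊆q k∈p) }
⊆-or-∃∈─ (inside ∷ p) (outside ∷ q) | inj₁ _ = inj₂ (zero , here , λ ())

p∪⁅x⁆─q≡p─q : ∀ {n} {x : Fin n} (p q : Subset n) → x ∈ q → (p ∪ ⁅ x ⁆) ─ q ≡ p ─ q
p∪⁅x⁆─q≡p─q (_ ∷ p) (inside ∷ q) here = cong (λ r → outside ∷ (r ─ q)) (∪-identityʳ p)
p∪⁅x⁆─q≡p─q (_ ∷ p) (inside ∷ q) (there x∈q) = cong (outside ∷_) (p∪⁅x⁆─q≡p─q p q x∈q)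
p∪⁅x⁆─q≡p─q (s ∷ p) (outside ∷ q) (there x∈q) =
  cong₂ _∷_ (∨-identityʳ s) (p∪⁅x⁆─q≡p─q p q x∈q)

∣p-x─q∣<∣p─q∣ : ∀ {n} {x : Fin n} (p q : Subset n) → x ∈ p → x ∉ q → ∣ p - x ─ q ∣ < ∣ p ─ q ∣
∣p-x─q∣<∣p─q∣ p q x∈p x∉q =
  subst (_< ∣ p ─ q ∣) (cong ∣_∣ (sym (p─q─r≡p─r─q p _ q))) (x∈p⇒∣p-x∣<∣p∣ (x∈p∧x∉q⇒x∈p─q x∈p x∉q))

⊆⁅x⁆⇒∣∣≤1 : ∀ {n} {p : Subset n} (x : Fin n) → p ⊆ ⁅ x ⁆ → ∣ p ∣ ≤ 1
⊆⁅x⁆⇒∣∣≤1 x p⊆⁅x⁆ = subst (_ ≤_) (∣⁅x⁆∣≡1 x) (p⊆q⇒∣p∣≤∣q∣ p⊆⁅x⁆)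

exchange-neighbour : ∀ {n} (p : Subset n) (i j : Fin n) →
  ∣ (p ∪ ⁅ i ⁆) - j ─ p ∣ ≤ 1 × ∣ p ─ ((p ∪ ⁅ i ⁆) - j) ∣ ≤ 1
exchange-neighbour p i j = ⊆⁅x⁆⇒∣∣≤1 i gained , ⊆⁅x⁆⇒∣∣≤1 j lost
  where
  gained : (p ∪ ⁅ i ⁆) - j ─ p ⊆ ⁅ i ⁆
  gained k∈ with x∈p─q⁻ ((p ∪ ⁅ i ⁆) - j) p k∈
  ... | k∈p∪i-j , k∉p with x∈p─q⁻ (p ∪ ⁅ i ⁆) ⁅ j ⁆ k∈p∪i-j
  ...   | k∈p∪i , _ with x∈p∪q⁻ p ⁅ i ⁆ k∈p∪i
  ...     | inj₁ k∈p = contradiction k∈p k∉p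
  ...     | inj₂ k∈i = k∈i
  lost : p ─ ((p ∪ ⁅ i ⁆) - j) ⊆ ⁅ j ⁆
  lost {k} k∈ with x∈p─q⁻ p ((p ∪ ⁅ i ⁆) - j) k∈ | k ∈? ⁅ j ⁆
  ... | _ , _ | yes k∈j = k∈j
  ... | k∈p , k∉p∪i-j | no k∉j = contradiction (x∈p∧x∉q⇒x∈p─q (p⊆p∪q ⁅ i ⁆ k∈p) k∉j) k∉p∪i-j

module OrderedAbelianGroupProperties {a ℓ : Level} (G : OrderedAbelianGroup a ℓ) where
  open OrderedAbelianGroup G

  +-isAbelianGroup : IsAbelianGroup _≡_ _+_ 0# (λ x → - x)
  +-isAbelianGroup = record
    { isGroup = record
      { isMonoid = record
        { isSemigroup = record
          { isMagma = record { isEquivalence = isEquivalence ; ∙-cong = cong₂ _+_ }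
          ; assoc = +-assoc
          }
        ; identity = comm∧idˡ⇒id +-comm +-identityˡ
        }
      ; inverse = comm∧invˡ⇒inv +-comm -‿inverseˡ
      ; ⁻¹-cong = cong (λ x → - x)
      }
    ; comm = +-comm
    }

  +-abelianGroup : AbelianGroup a a
  +-abelianGroup = record { isAbelianGroup = +-isAbelianGroup }

  open AbelianGroup +-abelianGroup using (group; commutativeSemigroup)
  open AbelianGroupProperties +-abelianGroup using (⁻¹-∙-comm)
  open CommutativeSemigroupProperties commutativeSemigroup using (interchange)
  open CommutativeSemigroupProperties commutativeSemigroup public using (x∙yz≈y∙xz; xy∙z≈y∙xz)
  open GroupProperties group using (//-rightDividesʳ)
  open ≡-Reasoning

  +-mono-≤ : ∀ {p q r s} → p ≤ᵍ q → r ≤ᵍ s → p + r ≤ᵍ q + s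
  +-mono-≤ {p} {q} {r} {s} p≤q r≤s =
    ≤-trans (+-monoˡ-≤ r p≤q) (subst₂ _≤ᵍ_ (+-comm r q) (+-comm s q) (+-monoˡ-≤ q r≤s))

  +-cancelʳ-≤ : ∀ {p q} r → p + r ≤ᵍ q + r → p ≤ᵍ q
  +-cancelʳ-≤ {p} {q} r h = subst₂ _≤ᵍ_ (//-rightDividesʳ r p) (//-rightDividesʳ r q) (+-monoˡ-≤ (- r) h)

  -ᵍ-interchange : ∀ p q s t → (p -ᵍ s) + (q -ᵍ t) ≡ (p + q) -ᵍ (s + t)
  -ᵍ-interchange p q s t = begin
    (p + - s) + (q + - t)  ≡⟨ interchange p (- s) q (- t) ⟩
    (p + q) + (- s + - t)  ≡⟨ cong ((p + q) +_) (⁻¹-∙-comm s t) ⟩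
    (p + q) + - (s + t)    ∎

  -- An inequality between sums survives subtracting two pairs of terms
  -- with equal sums; this is why tilting by a modular function preserves
  -- exchange inequalities.
  subtract-balanced : ∀ {p q r s} {p′ q′ r′ s′} → p + q ≤ᵍ r + s → p′ + q′ ≡ r′ + s′ →
    (p -ᵍ p′) + (q -ᵍ q′) ≤ᵍ (r -ᵍ r′) + (s -ᵍ s′)
  subtract-balanced {p} {q} {r} {s} {p′} {q′} {r′} {s′} h e =
    subst₂ _≤ᵍ_ (sym (-ᵍ-interchange p q p′ q′))
      (trans (cong (λ w → (r + s) -ᵍ w) e) (sym (-ᵍ-interchange r s r′ s′)))
      (+-monoˡ-≤ (- (p′ + q′)) h)

module _ {a ℓ : Level} (G : OrderedAbelianGroup a ℓ) where
  open OrderedAbelianGroup G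
  open OrderedAbelianGroupProperties G
  open ≡-Reasoning

  sumOver-insert : ∀ {n} (x : Fin n → Carrier) {i : Fin n} (p : Subset n) → i ∉ p →
    sumOver G x (p ∪ ⁅ i ⁆) ≡ x i + sumOver G x p
  sumOver-insert x {zero} (outside ∷ p) _ =
    cong (x zero +_) (trans (cong (sumOver G (λ k → x (suc k))) (∪-identityʳ p)) (sym (+-identityˡ _)))
  sumOver-insert x {zero} (inside ∷ p) i∉p = contradiction here i∉p
  sumOver-insert x {suc i} (s ∷ p) i∉p = begin
    head (s ∨ outside) + sumOver G x′ (p ∪ ⁅ i ⁆) ≡⟨ cong₂ _+_ (cong head (∨-identityʳ s))
                                                       (sumOver-insert x′ p (λ i∈p → i∉p (there i∈p))) ⟩
    head s + (x′ i + sumOver G x′ p)              ≡⟨ x∙yz≈y∙xz (head s) (x′ i) _ ⟩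
    x′ i + (head s + sumOver G x′ p)              ∎
    where
    x′ : Fin _ → Carrier
    x′ k = x (suc k)
    head : Side → Carrier
    head b = if b then x zero else 0#

  sumOver-remove : ∀ {n} (x : Fin n → Carrier) {i : Fin n} (p : Subset n) → i ∈ p →
    sumOver G x p ≡ x i + sumOver G x (p - i)
  sumOver-remove x {zero} (inside ∷ p) here =
    cong (x zero +_) (trans (cong (sumOver G (λ k → x (suc k))) (sym (p─⊥≡p p))) (sym (+-identityˡ _)))
  sumOver-remove x {suc i} (s ∷ p) (there i∈p) = begin
    head s + sumOver G x′ p                ≡⟨ cong (head s +_) (sumOver-remove x′ p i∈p) ⟩
    head s + (x′ i + sumOver G x′ (p - i)) ≡⟨ x∙yz≈y∙xz (head s) (x′ i) _ ⟩
    x′ i + (head s + sumOver G x′ (p - i)) ∎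
    where
    x′ : Fin _ → Carrier
    x′ k = x (suc k)
    head : Side → Carrier
    head b = if b then x zero else 0#

  sumOver-move : ∀ {n} (x : Fin n → Carrier) {i : Fin n} (p q : Subset n) → i ∈ p → i ∉ q →
    sumOver G x p + sumOver G x q ≡ sumOver G x (p - i) + sumOver G x (q ∪ ⁅ i ⁆)
  sumOver-move x {i} p q i∈p i∉q = begin
    sumOver G x p + sumOver G x q                ≡⟨ cong (_+ sumOver G x q) (sumOver-remove x p i∈p) ⟩
    (x i + sumOver G x (p - i)) + sumOver G x q  ≡⟨ xy∙z≈y∙xz (x i) _ _ ⟩
    sumOver G x (p - i) + (x i + sumOver G x q)  ≡⟨ cong (sumOver G x (p - i) +_) (sym (sumOver-insert x q i∉q)) ⟩
    sumOver G x (p - i) + sumOver G x (q ∪ ⁅ i ⁆) ∎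

  sumOver-swap : ∀ {n} (x : Fin n → Carrier) {i j : Fin n} (p q : Subset n) →
    i ∈ p → i ∉ q → j ∈ q → j ∉ p →
    sumOver G x p + sumOver G x q ≡ sumOver G x ((p - i) ∪ ⁅ j ⁆) + sumOver G x ((q ∪ ⁅ i ⁆) - j)
  sumOver-swap x {i} {j} p q i∈p i∉q j∈q j∉p = begin
    S p + S q                            ≡⟨ sumOver-move x p q i∈p i∉q ⟩
    S (p - i) + S (q ∪ ⁅ i ⁆)            ≡⟨ +-comm _ _ ⟩
    S (q ∪ ⁅ i ⁆) + S (p - i)            ≡⟨ sumOver-move x (q ∪ ⁅ i ⁆) (p - i) (p⊆p∪q ⁅ i ⁆ j∈q)
                                             (λ j∈p-i → j∉p (p─q⊆p p ⁅ i ⁆ j∈p-i)) ⟩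
    S ((q ∪ ⁅ i ⁆) - j) + S ((p - i) ∪ ⁅ j ⁆) ≡⟨ +-comm _ _ ⟩
    S ((p - i) ∪ ⁅ j ⁆) + S ((q ∪ ⁅ i ⁆) - j) ∎
    where
    S : Subset _ → Carrier
    S = sumOver G x

  tilt : ∀ {n} → (Subset n → Carrier) → (Fin n → Carrier) → Subset n → Carrier
  tilt f x Y = f Y -ᵍ sumOver G x Y

  tilt-MnatConcave : ∀ {n} {f : Subset n → Carrier} {x : Fin n → Carrier} →
    MnatConcave G f → MnatConcave G (tilt f x)
  tilt-MnatConcave {x = x} M X Y i i∈X i∉Y with M X Y i i∈X i∉Y
  ... | inj₁ ex = inj₁ (subtract-balanced ex (sumOver-move x X Y i∈X i∉Y))
  ... | inj₂ (j , j∈Y , j∉X , ex) =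
    inj₂ (j , j∈Y , j∉X , subtract-balanced ex (sumOver-swap x X Y i∈X i∉Y j∈Y j∉X))

  Δ22-Maximal : ∀ {n} → (Subset n → Carrier) → Subset n → Set ℓ
  Δ22-Maximal g X = ∀ Y → (Y ⊆ X ⊎ Y ⊇ X ⊎ (∣ Y ─ X ∣ ≤ 1 × ∣ X ─ Y ∣ ≤ 1)) → g Y ≤ᵍ g X

  Δ22-maximal⇒maximal : ∀ {n} {g : Subset n → Carrier} {X : Subset n} →
    MnatConcave G g → Δ22-Maximal g X → ∀ Y → g Y ≤ᵍ g X
  Δ22-maximal⇒maximal {g = g} {X} M local Y = bounded (suc ∣ Y ─ X ∣) Y (n<1+n _)
    where
    dominated : ∀ {Z Z′ X′} → g Z + g X ≤ᵍ g Z′ + g X′ → g Z′ ≤ᵍ g X → g X′ ≤ᵍ g X → g Z ≤ᵍ g X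
    dominated ex Z′≤X X′≤X = +-cancelʳ-≤ (g X) (≤-trans ex (+-mono-≤ Z′≤X X′≤X))

    closer : ∀ {m i Z} → i ∈ Z → i ∉ X → ∣ Z ─ X ∣ < suc m → ∣ Z - i ─ X ∣ < m
    closer {Z = Z} i∈Z i∉X bound = <-≤-trans (∣p-x─q∣<∣p─q∣ Z X i∈Z i∉X) (s≤s⁻¹ bound)

    bounded : ∀ m Z → ∣ Z ─ X ∣ < m → g Z ≤ᵍ g X
    bounded zero Z ()
    bounded (suc m) Z bound with ⊆-or-∃∈─ Z X
    ... | inj₁ Z⊆X = local Z (inj₁ Z⊆X)
    ... | inj₂ (i , i∈Z , i∉X) with M Z X i i∈Z i∉X
    ...   | inj₁ ex =
      dominated ex (bounded m (Z - i) (closer i∈Z i∉X bound))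
                   (local (X ∪ ⁅ i ⁆) (inj₂ (inj₁ (p⊆p∪q ⁅ i ⁆))))
    ...   | inj₂ (j , j∈X , _ , ex) =
      dominated ex (bounded m ((Z - i) ∪ ⁅ j ⁆)
                      (subst (_< m) (cong ∣_∣ (sym (p∪⁅x⁆─q≡p─q (Z - i) X j∈X))) (closer i∈Z i∉X bound)))
                   (local ((X ∪ ⁅ i ⁆) - j) (inj₂ (inj₂ (exchange-neighbour X i j))))

mainTheorem10 : {a ℓ : Level} (G : OrderedAbelianGroup a ℓ) (n : ℕ)
    (f : Subset n → OrderedAbelianGroup.Carrier G) →
    Submodular G f → f ⊥ ≡ OrderedAbelianGroup.0# G → MnatConcave G f →
    (X : Subset n) (x : Fin n → OrderedAbelianGroup.Carrier G) →
    (InSubdiff G f X x → InSubdiffΔ22 G f X x) × (InSubdiffΔ22 G f X x → InSubdiff G f X x)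
mainTheorem10 G n f _ _ M X x =
    (λ globally Y _ → globally Y)
  , Δ22-maximal⇒maximal G (tilt-MnatConcave G M)
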